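{- Let $T$ be a finite graph such that every graph homomorphism $T\to T$ is an automorphism ($\mathrm{End}(T)=\mathrm{Aut}(T)$). If there is a path component of $\mathrm{Hom}(T,K_{\chi(T)})$ which is invariant under the action of $\mathrm{Aut}(T)$ (acting by $c\mapsto c\circ\gamma$ for $\gamma\in\mathrm{Aut}(T)$), then there exists a graph $G$ with $\chi(G)=\chi(T)$ such that $\mathrm{Hom}(T,G)$ is non-empty and connected.
   Context: Graphs may have loops: a graph $G$ is a vertex set $V(G)$ with a symmetric relation $E(G)\subseteq V(G)\times V(G)$; a graph homomorphism $f\colon G\to H$ is a map $V(G)\to V(H)$ with $(f(u),f(v))\in E(H)$ whenever $(u,v)\in E(G)$. $K_r$ is the complete graph on $r$ vertices (no loops). For graphs $T,G$, $\mathrm{Hom}(T,G)$ is a cell complex whose vertices are the graph homomorphisms $T\to G$, and two such homomorphisms are joined by an edge exactly when they differ at exactly one vertex of $T$; path components and connectivity of $\mathrm{Hom}(T,G)$ are determined by this graph, and "connected" means non-empty and path-connected. -}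

module Defs where

open import Data.Nat using (ℕ; _<_)
open import Data.Fin using (Fin)
open import Data.Product using (Σ; _×_; ∃; ∃-syntax; _,_; proj₁)
open import Relation.Binary.PropositionalEquality using (_≡_) renaming (sym to ≡-sym)
open import Relation.Nullary using (¬_)

record Graph : Set₁ where
  field
    size : ℕ
    E    : Fin size → Fin size → Set
    sym  : ∀ {u v} → E u v → E v u
open Graph public

K : ℕ → Graph
K r = record { size = r ; E = λ i j → ¬ (i ≡ j) ; sym = λ ne eq → ne (≡-sym eq) }

IsHom : (T G : Graph) → (Fin (size T) → Fin (size G)) → Set
IsHom T G f = ∀ {u v} → E T u v → E G (f u) (f v)

-- Vertices of Hom(T,G).
Hom : Graph → Graph → Set
Hom T G = Σ (Fin (size T) → Fin (size G)) (IsHom T G)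

Adjacent : ∀ {T G} → Hom T G → Hom T G → Set
Adjacent {T} (f , _) (g , _) =
  Σ (Fin (size T)) λ v → ¬ (f v ≡ g v) × (∀ w → ¬ (w ≡ v) → f w ≡ g w)

-- Paths in the 1-skeleton of Hom(T,G) (homs equal pointwise are identified).
data Path (T G : Graph) : Hom T G → Hom T G → Set where
  stay : ∀ {f g : Hom T G} → (∀ x → proj₁ f x ≡ proj₁ g x) → Path T G f g
  step : ∀ {f g h : Hom T G} → Adjacent {T} {G} f g → Path T G g h → Path T G f h

HomConnected : Graph → Graph → Set
HomConnected T G = Hom T G × (∀ (f g : Hom T G) → Path T G f g)

IsAut : (T : Graph) → (Fin (size T) → Fin (size T)) → Set
IsAut T f = IsHom T T f × Σ (Fin (size T) → Fin (size T)) λ g →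
  IsHom T T g × (∀ x → g (f x) ≡ x) × (∀ y → f (g y) ≡ y)

Aut : Graph → Set
Aut T = Σ (Fin (size T) → Fin (size T)) (IsAut T)

EndIsAut : Graph → Set
EndIsAut T = ∀ (f : Fin (size T) → Fin (size T)) → IsHom T T f → IsAut T f

ChromaticNumber : Graph → ℕ → Set
ChromaticNumber G k = Hom G (K k) × (∀ j → j < k → ¬ Hom G (K j))

precomp : ∀ {T G : Graph} → Hom T G → Aut T → Hom T G
precomp (c , hc) (γ , hγ , _) = (λ x → c (γ x)) , (λ e → hc (hγ e))

{-# OPTIONS --safe #-}
module Submission where

-- Attach to T, for every automorphism γ, a long cylinder of copies of T whose two ends are glued to T
-- by id and by γ. A path from c to c ∘ γ in Hom(T, K_χ) is a χ-colouring of such a cylinder extending c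
-- on T, so the resulting graph G has χ(G) = χ(T). A cylinder with more than |T| cells has one that a
-- given hom T → G misses; pushing everything away from the missed cells deforms the hom into the base
-- copy of T, where it is an automorphism, and the cylinder of this automorphism connects it to id.
-- As E T need not be decidable, all pairs of a self-map and a sequence of colourings (finitely many)
-- index a cylinder, and its edges are guarded by the validity of the pair. This needs a uniform bound
-- on the length of the paths, which comes from excising their loops.

open import Defs
open import Data.Fin using (Fin; toℕ; fromℕ<; finToFun; funToFin)
import Data.Fin as Fin
open import Data.Fin.Properties
  using (toℕ<n; toℕ≤pred[n]; toℕ-fromℕ<; fromℕ<-toℕ; finToFun-funToFin; +↔⊎; *↔×;
         any?; ¬∀⟶∃¬; pigeonhole; injective⇒≤)
open import Data.List using (List; []; _∷_; allFin)
open import Data.List.Membership.Propositional using (_∈_; _∉_)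
open import Data.List.Membership.Propositional.Properties using (∈-allFin)
open import Data.List.Relation.Unary.Any using (here; there)
open import Data.Nat using (ℕ; zero; suc; _+_; _*_; _∸_; _^_; _⊓_; _⊔_; _≤_; _<_; _≤?_; _<?_; z≤n; s≤s)
open import Data.Nat.Induction using (<-wellFounded)
open import Data.Nat.Properties
open import Data.Product using (Σ; _×_; _,_; proj₁; proj₂; ∃-syntax)
open import Data.Product.Function.NonDependent.Propositional using (_×-cong_)
open import Data.Sum using (_⊎_; inj₁; inj₂)
open import Data.Sum.Function.Propositional using (_⊎-cong_)
open import Data.Vec.Functional using (updateAt)
open import Data.Vec.Functional.Properties using (updateAt-updates; updateAt-minimal)
open import Function using (_∘_; id; const; _↔_; Inverse)
open import Function.Properties.Inverse using (↔-refl; ↔-trans)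
open import Induction.WellFounded using (Acc; acc)
open import Relation.Binary.PropositionalEquality
  using (_≡_; _≢_; _≗_; refl; trans; cong; subst; subst₂) renaming (sym to ≡-sym)
open import Relation.Nullary using (¬_; Dec; yes; no; contradiction)

-- Paths between linked homomorphisms.

module _ {T G : Graph} where

  path-respˡ : {f g h : Hom T G} → proj₁ f ≗ proj₁ g → Path T G g h → Path T G f h
  path-respˡ f≗g (stay g≗h) = stay (λ x → trans (f≗g x) (g≗h x))
  path-respˡ f≗g (step {g = g′} (v , gv≢ , same) p) =
    step {g = g′} (v , (λ e → gv≢ (trans (≡-sym (f≗g v)) e)) , λ w w≢v → trans (f≗g w) (same w w≢v)) p

  path-trans : {f g h : Hom T G} → Path T G f g → Path T G g h → Path T G f h
  path-trans {f} {g} {h} (stay f≗g) q = path-respˡ {f} {g} {h} f≗g q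
  path-trans (step a p) q = step a (path-trans p q)

  path-sym : {f g : Hom T G} → Path T G f g → Path T G g f
  path-sym (stay f≗g) = stay (≡-sym ∘ f≗g)
  path-sym {f} (step {g = g′} (v , fv≢ , same) p) =
    path-trans (path-sym p)
      (step {f = g′} {g = f} (v , fv≢ ∘ ≡-sym , λ w w≢v → ≡-sym (same w w≢v)) (stay (λ _ → refl)))

  -- With f = g this is IsHom; in general it is an edge of the exponential graph G^T.
  Linked : (f g : Fin (size T) → Fin (size G)) → Set
  Linked f g = ∀ {u v} → E T u v → E G (f u) (g v)

  linked-sym : ∀ {f g} → Linked f g → Linked g f
  linked-sym l e = sym G (l (sym T e))

  private
    -- Values are switched from `f` to `g` one vertex at a time. Each intermediate map takes its
    -- values from `f` and `g`, so every edge is handled by `hf`, `hg` or `l`, and it stays linked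
    -- to `g`.
    path-linked-on : (vs : List (Fin (size T))) (f g : Hom T G) → Linked (proj₁ f) (proj₁ g) →
      (∀ t → t ∉ vs → proj₁ f t ≡ proj₁ g t) → Path T G f g
    path-linked-on [] f g l same = stay (λ t → same t λ ())
    path-linked-on (v ∷ vs) (f , hf) (g , hg) l same = f⇝h
      where
      h = updateAt f v (const (g v))

      h-either : ∀ t → h t ≡ f t ⊎ h t ≡ g t
      h-either t with t Fin.≟ v
      ... | yes refl = inj₂ (updateAt-updates t f)
      ... | no t≢v = inj₁ (updateAt-minimal t v f t≢v)

      h-g : Linked h g
      h-g {u} e with h-either u
      ... | inj₁ p rewrite p = l e
      ... | inj₂ p rewrite p = hg e

      f-h : Linked f h
      f-h {_} {w} e with h-either w
      ... | inj₁ p rewrite p = hf e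
      ... | inj₂ p rewrite p = l e

      hh : IsHom T G h
      hh {_} {w} e with h-either w
      ... | inj₁ p rewrite p = linked-sym {f} {h} f-h e
      ... | inj₂ p rewrite p = h-g e

      h-same : ∀ t → t ∉ vs → h t ≡ g t
      h-same t t∉vs with t Fin.≟ v
      ... | yes refl = updateAt-updates t f
      ... | no t≢v = trans (updateAt-minimal t v f t≢v)
                       (same t λ { (here p) → t≢v p ; (there p) → t∉vs p })

      h⇝g : Path T G (h , hh) (g , hg)
      h⇝g = path-linked-on vs (h , hh) (g , hg) h-g h-same

      f⇝h : Path T G (f , hf) (g , hg)
      f⇝h with f v Fin.≟ g v
      ... | no fv≢gv = step {g = h , hh}
              (v , (λ e → fv≢gv (trans e (updateAt-updates v f))) ,
               λ w w≢v → ≡-sym (updateAt-minimal w v f w≢v)) h⇝g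
      -- `Adjacent` demands a difference, so agreement at `v` contributes no step.
      ... | yes fv≡gv = path-respˡ {f , hf} {h , hh} {g , hg} f≗h h⇝g
        where
        f≗h : f ≗ h
        f≗h t with t Fin.≟ v
        ... | yes refl = trans fv≡gv (≡-sym (updateAt-updates t f))
        ... | no t≢v = ≡-sym (updateAt-minimal t v f t≢v)

  path-linked : (f g : Hom T G) → Linked (proj₁ f) (proj₁ g) → Path T G f g
  path-linked f g l = path-linked-on (allFin _) f g l (λ t t∉ → contradiction (∈-allFin t) t∉)

-- Homotopies along positions at distance at most one.

Near : ℕ → ℕ → Set
Near i j = i ≤ suc j × j ≤ suc i

near-sym : ∀ {i j} → Near i j → Near j i
near-sym (p , q) = q , p

near-refl : ∀ {i} → Near i i
near-refl = n≤1+n _ , n≤1+n _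

near-suc : ∀ {i} → Near i (suc i)
near-suc = ≤-trans (n≤1+n _) (n≤1+n _) , ≤-refl

near-cases : ∀ {i j} → Near i j → i ≡ j ⊎ suc i ≡ j ⊎ i ≡ suc j
near-cases {i} {j} (p , q) with m≤n⇒m<n∨m≡n p
... | inj₂ e = inj₂ (inj₂ e)
... | inj₁ (s≤s i≤j) with m≤n⇒m<n∨m≡n i≤j
...   | inj₂ e = inj₁ e
...   | inj₁ i<j = inj₂ (inj₁ (≤-antisym i<j q))

∸-near : ∀ N {s t} → Near s t → Near (N ∸ s) (N ∸ t)
∸-near N (p , q) = half N q , half N p
  where
  half : ∀ N {s t} → t ≤ suc s → N ∸ s ≤ suc (N ∸ t)
  half N {s} {t} t≤ = m≤n+o⇒m∸n≤o N s (≤-trans (m≤n+m∸n N t)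
    (≤-trans (+-monoˡ-≤ (N ∸ t) t≤) (≤-reflexive (≡-sym (+-suc s (N ∸ t))))))

⊓-near : ∀ {i j s t} → Near i j → Near s t → Near (i ⊓ s) (j ⊓ t)
⊓-near (p , q) (p′ , q′) = ⊓-mono-≤ p p′ , ⊓-mono-≤ q q′

⊔-near : ∀ {i j s t} → Near i j → Near s t → Near (i ⊔ s) (j ⊔ t)
⊔-near (p , q) (p′ , q′) = ⊔-mono-≤ p p′ , ⊔-mono-≤ q q′

module _ {T G : Graph} (H : ℕ → Fin (size T) → Fin (size G))
  (linked : ∀ {s t} → Near s t → Linked {T} {G} (H s) (H t)) where

  -- By `linked`, `H` is a homomorphism to `G` from the product of `T` with a path that has a loop
  -- at each vertex, so consecutive stages are linked homomorphisms.
  homotopy⇒path : ∀ m (f g : Hom T G) → proj₁ f ≗ H 0 → H m ≗ proj₁ g → Path T G f g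
  homotopy⇒path zero f g f≗ ≗g = stay (λ x → trans (f≗ x) (≗g x))
  homotopy⇒path (suc m) f g f≗ ≗g = path-trans
    (homotopy⇒path m f (H m , linked near-refl) f≗ (λ _ → refl))
    (path-trans (path-linked (H m , linked near-refl) (H (suc m) , linked near-refl) (linked near-suc))
      (stay ≗g))

-- Walks in a finite set and the removal of their loops.

module _ {M : ℕ} (R : Fin M → Fin M → Set) (P Q : Fin M → Set) where

  -- The sequence is infinite and remains in `Q` from `ℓ` on, so an early arrival also counts as any
  -- longer walk.
  record Walk (ℓ : ℕ) : Set where
    field
      at     : ℕ → Fin M
      move   : ∀ j → R (at j) (at (suc j))
      source : P (at 0)
      target : ∀ j → ℓ ≤ j → Q (at j)
  open Walk public

  excise : ∀ {ℓ} (w : Walk ℓ) i d → at w i ≡ at w (i + suc d) → i + suc d ≤ ℓ → Walk (ℓ ∸ suc d)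
  excise {ℓ} w i d loop i+d≤ℓ = record
    { at = at′
    ; move = move′
    ; source = subst P (≡-sym (before z≤n)) (source w)
    ; target = λ j ℓ∸d≤j → subst Q (≡-sym (after (≤-trans (m+n≤o⇒m≤o∸n i i+d≤ℓ) ℓ∸d≤j)))
        (target w (j + suc d) (m∸n≤o⇒m≤o+n ℓ (suc d) ℓ∸d≤j))
    }
    where
    m∸n≤o⇒m≤o+n : ∀ m n {o} → m ∸ n ≤ o → m ≤ o + n
    m∸n≤o⇒m≤o+n m n {o} p =
      ≤-trans (m≤n+m∸n m n) (≤-trans (+-monoʳ-≤ n p) (≤-reflexive (+-comm n o)))

    at′ : ℕ → Fin M
    at′ j with j ≤? i
    ... | yes _ = at w j
    ... | no _ = at w (j + suc d)

    before : ∀ {j} → j ≤ i → at′ j ≡ at w j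
    before {j} j≤i with j ≤? i
    ... | yes _ = refl
    ... | no j≰i = contradiction j≤i j≰i

    after : ∀ {j} → i ≤ j → at′ j ≡ at w (j + suc d)
    after {j} i≤j with j ≤? i
    ... | no _ = refl
    -- At `j = i` both formulas for `at′` apply, and `loop` makes them agree.
    ... | yes j≤i with refl ← ≤-antisym i≤j j≤i = loop

    move′ : ∀ j → R (at′ j) (at′ (suc j))
    move′ j with ≤-<-connex i j
    ... | inj₁ i≤j = subst₂ R (≡-sym (after i≤j)) (≡-sym (after (≤-trans i≤j (n≤1+n j))))
                       (move w (j + suc d))
    ... | inj₂ j<i = subst₂ R (≡-sym (before (<⇒≤ j<i))) (≡-sym (before j<i)) (move w j)

  -- Among the positions 0 to `M` some state repeats; if `M ≤ ℓ` this loop lies within the walk and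
  -- is excised.
  shorten : ∀ {ℓ} → Walk ℓ → Walk M
  shorten {ℓ} = go (<-wellFounded ℓ)
    where
    go : ∀ {ℓ} → Acc _<_ ℓ → Walk ℓ → Walk M
    go {ℓ} (acc rec) w with ≤-total ℓ M
    ... | inj₁ ℓ≤M = record
      { at = at w ; move = move w ; source = source w ; target = λ j M≤j → target w j (≤-trans ℓ≤M M≤j) }
    ... | inj₂ M≤ℓ with pigeonhole (n<1+n M) (at w ∘ toℕ)
    ...   | i , j , i<j , loop with m≤n⇒∃[o]m+o≡n i<j
    ...     | d , i+d≡j = go (rec (∸-monoʳ-< {ℓ} {suc d} {0} (s≤s z≤n) (≤-trans (m≤n+m (suc d) (toℕ i)) bound)))
                             (excise w (toℕ i) d (trans loop (cong (at w) (≡-sym e))) bound)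
      where
      e : toℕ i + suc d ≡ toℕ j
      e = trans (+-suc (toℕ i) d) i+d≡j
      bound : toℕ i + suc d ≤ ℓ
      bound = ≤-trans (≤-reflexive e) (≤-trans (toℕ≤pred[n] j) M≤ℓ)

-- The graph of cylinders glued to T.

module Cylinders (T : Graph) (r : ℕ) (c : Fin (size T) → Fin r) (L : ℕ) where

  n : ℕ
  n = size T

  -- A cylinder is a code of a pair (γ , w) of a self-map γ of T and a sequence w of L colourings.
  Cylinder Vertex : Set
  Cylinder = Fin (n ^ n) × Fin ((r ^ n) ^ L)
  Vertex = Fin n ⊎ (Cylinder × (Fin L × Fin n))

  pattern base t = inj₁ t
  pattern cell k i t = inj₂ (k , i , t)

  glue : Cylinder → Fin n → Fin n
  glue (γ , _) = finToFun γ

  colour : Vertex → Fin r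
  colour (base t) = c t
  colour (cell (_ , w) i t) = finToFun (finToFun w i) t

  -- Positions 0 and j > L are the two ends of the cylinder.
  slice : Cylinder → ℕ → Fin n → Vertex
  slice k zero t = base t
  slice k (suc j) t with j <? L
  ... | yes j<L = cell k (fromℕ< j<L) t
  ... | no _ = base (glue k t)

  slice-cell : ∀ k i t → slice k (suc (toℕ i)) t ≡ cell k i t
  slice-cell k i t with toℕ i <? L
  ... | yes i<L = cong (λ i → cell k i t) (fromℕ<-toℕ i i<L)
  ... | no i≮L = contradiction (toℕ<n i) i≮L

  slice-end : ∀ k {j} t → L < j → slice k j t ≡ base (glue k t)
  slice-end k {suc j} t (s≤s L≤j) with j <? L
  ... | yes j<L = contradiction j<L (≤⇒≯ L≤j)
  ... | no _ = refl

  Valid : Cylinder → Set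
  Valid k = IsHom T T (glue k) ×
    (∀ {i j u v} → Near i j → E T u v → colour (slice k i u) ≢ colour (slice k j v))

  -- Cells of an invalid code are isolated. Edges within the base also come from valid cylinders
  -- only, which is why `baseHom` takes a valid code.
  data Edge (x y : Vertex) : Set where
    edge : ∀ k {i j u v} → Valid k → Near i j → E T u v →
           x ≡ slice k i u → y ≡ slice k j v → Edge x y

  edge-sym : ∀ {x y} → Edge x y → Edge y x
  edge-sym (edge k valid i∼j e x≡ y≡) = edge k valid (near-sym i∼j) (sym T e) y≡ x≡

  slice-edge : ∀ k → Valid k → ∀ {i j u v} → Near i j → E T u v → Edge (slice k i u) (slice k j v)
  slice-edge k valid i∼j e = edge k valid i∼j e refl refl

  colour-proper : ∀ {x y} → Edge x y → colour x ≢ colour y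
  colour-proper (edge k (_ , proper) i∼j e refl refl) = proper i∼j e

  abstract
    vertex↔ : Fin (n + (n ^ n * (r ^ n) ^ L) * (L * n)) ↔ Vertex
    vertex↔ = ↔-trans +↔⊎ (↔-refl ⊎-cong ↔-trans *↔× (*↔× ×-cong *↔×))

  open Inverse vertex↔ public renaming (to to decode; from to encode)
    using (strictlyInverseˡ; strictlyInverseʳ)

  graph : Graph
  graph = record
    { size = n + (n ^ n * (r ^ n) ^ L) * (L * n)
    ; E = λ x y → Edge (decode x) (decode y)
    ; sym = edge-sym
    }

  encode-edge : ∀ {x y} → Edge x y → E graph (encode x) (encode y)
  encode-edge {x} {y} = subst₂ Edge (≡-sym (strictlyInverseˡ x)) (≡-sym (strictlyInverseˡ y))

  colouring : Hom graph (K r)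
  colouring = colour ∘ decode , colour-proper

  baseHom : ∀ {k} → Valid k → Hom T T → Hom T graph
  baseHom {k} valid (α , hα) =
    encode ∘ base ∘ α , λ e → encode-edge (slice-edge k valid {0} {0} near-refl (hα e))

  -- Once the cells at the positions cut k are removed, what remains of each cylinder retracts to the
  -- base: contract is the homotopy moving every position away from the cut, and retract its end.
  module Cut (cut : Cylinder → Fin L) where

    gap : Cylinder → ℕ
    gap k = suc (toℕ (cut k))

    -- As `s` grows to `suc L`, positions below `a` sink to 0 and the others rise past `L`.
    push : ℕ → ℕ → ℕ → ℕ
    push a s j with j <? a
    ... | yes _ = j ⊓ (suc L ∸ s)
    ... | no _ = j ⊔ s

    -- Near positions other than `a` lie on the same side of `a`, where one formula governs both.
    push-near : ∀ a {i j s t} → i ≢ a → j ≢ a → Near i j → Near s t → Near (push a s i) (push a t j)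
    push-near a {i} {j} i≢a j≢a (p , q) s∼t with i <? a | j <? a
    ... | yes _ | yes _ = ⊓-near (p , q) (∸-near (suc L) s∼t)
    ... | no _ | no _ = ⊔-near (p , q) s∼t
    ... | yes i<a | no j≮a = contradiction (≤-antisym (≤-trans q i<a) (≮⇒≥ j≮a)) j≢a
    ... | no i≮a | yes j<a = contradiction (≤-antisym (≤-trans p j<a) (≮⇒≥ i≮a)) i≢a

    contract : ℕ → Vertex → Vertex
    contract s (base t) = base t
    contract s (cell k i t) = slice k (push (gap k) s (suc (toℕ i))) t

    -- Positions beyond `L` lie above the gap, so `push` keeps them beyond `L`, in the glued end
    -- that `contract` fixes.
    contract-slice : ∀ s k j t → contract s (slice k j t) ≡ slice k (push (gap k) s j) t
    contract-slice s k zero t = refl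
    contract-slice s k (suc j) t with j <? L
    ... | yes j<L rewrite toℕ-fromℕ< j<L = refl
    ... | no j≮L with suc j <? gap k
    ...   | yes (s≤s j<cut) = contradiction (<-trans j<cut (toℕ<n (cut k))) j≮L
    ...   | no _ = ≡-sym (slice-end k t (≤-trans (s≤s (≮⇒≥ j≮L)) (m≤m⊔n (suc j) s)))

    contract-start : ∀ x → contract 0 x ≡ x
    contract-start (base t) = refl
    contract-start (cell k i t) with suc (toℕ i) <? gap k
    ... | yes _ rewrite m≤n⇒m⊓n≡m (<⇒≤ (toℕ<n i)) = slice-cell k i t
    ... | no _ = slice-cell k i t

    retract : Vertex → Fin n
    retract (base t) = t
    retract (cell k i t) with suc (toℕ i) <? gap k
    ... | yes _ = t
    ... | no _ = glue k t

    contract-end : ∀ x → contract (suc L) x ≡ base (retract x)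
    contract-end (base t) = refl
    contract-end (cell k i t) with suc (toℕ i) <? gap k
    ... | yes _ rewrite n∸n≡0 L | ⊓-zeroʳ (suc (toℕ i)) = refl
    ... | no _ = slice-end k t (m≤n⊔m (suc (toℕ i)) (suc L))

    Avoids : Vertex → Set
    Avoids x = ∀ k t → x ≢ cell k (cut k) t

    avoids-gap : ∀ {x} k {j t} → Avoids x → x ≡ slice k j t → j ≢ gap k
    avoids-gap k {t = t} avoids x≡ refl = avoids k t (trans x≡ (slice-cell k (cut k) t))

    contract-edge : ∀ {x y s t} → Avoids x → Avoids y → Near s t → Edge x y →
      Edge (contract s x) (contract t y)
    contract-edge {s = s} {t} ax ay s∼t (edge k {i} {j} {u} {v} valid i∼j e x≡ y≡) =
      edge k valid (push-near (gap k) (avoids-gap k ax x≡) (avoids-gap k ay y≡) i∼j s∼t) e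
        (trans (cong (contract s) x≡) (contract-slice s k i u))
        (trans (cong (contract t) y≡) (contract-slice t k j v))

  -- Deforming homomorphisms into the base.

  base-injective : ∀ {t t′} → _≡_ {A = Vertex} (base t) (base t′) → t ≡ t′
  base-injective refl = refl

  slice-base : ∀ k j {t t′} → base t ≡ slice k j t′ → (j ≡ 0 × t ≡ t′) ⊎ (L < j × t ≡ glue k t′)
  slice-base k zero refl = inj₁ (refl , refl)
  slice-base k (suc j) t≡ with j <? L
  ... | no j≮L = inj₂ (s≤s (≮⇒≥ j≮L) , base-injective t≡)

  -- The two ends of a cylinder are never near when `0 < L`, so the edge lies within one end: it is
  -- an edge of `T` or the image of one under the gluing map.
  base-edge : 0 < L → ∀ {u v} → Edge (base u) (base v) → E T u v
  base-edge 0<L (edge k {i} {j} (hγ , _) (p , q) e u≡ v≡) with slice-base k i u≡ | slice-base k j v≡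
  ... | inj₁ (_ , refl) | inj₁ (_ , refl) = e
  ... | inj₂ (_ , refl) | inj₂ (_ , refl) = hγ e
  ... | inj₁ (refl , _) | inj₂ (L<j , _) = contradiction (≤-trans L<j q) (<⇒≱ (s≤s 0<L))
  ... | inj₂ (L<i , _) | inj₁ (refl , _) = contradiction (≤-trans L<i p) (<⇒≱ (s≤s 0<L))

  -- If every cell of the cylinder were hit, choosing preimages would inject `Fin L` into `Fin n`.
  missed : n < L → (f : Fin n → Fin (size graph)) → ∀ k → ∃[ i ] (∀ t t′ → f t ≢ encode (cell k i t′))
  missed n<L f k = let i , ¬hit = ¬∀⟶∃¬ L Hit hit? all-hit⇒⊥ in i , λ t t′ e → ¬hit (t , t′ , e)
    where
    Hit : Fin L → Set
    Hit i = ∃[ t ] ∃[ t′ ] f t ≡ encode (cell k i t′)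

    hit? : ∀ i → Dec (Hit i)
    hit? i = any? (λ t → any? (λ t′ → f t Fin.≟ encode (cell k i t′)))

    cell-injective : ∀ {i j t t′} → _≡_ {A = Vertex} (cell k i t) (cell k j t′) → i ≡ j
    cell-injective refl = refl

    encode-injective : ∀ {x y} → encode x ≡ encode y → x ≡ y
    encode-injective {x} {y} e =
      trans (≡-sym (strictlyInverseˡ x)) (trans (cong decode e) (strictlyInverseˡ y))

    all-hit⇒⊥ : ¬ (∀ i → Hit i)
    all-hit⇒⊥ hit = <⇒≱ n<L (injective⇒≤ {f = proj₁ ∘ hit} λ {i} {j} e →
      cell-injective (encode-injective
        (trans (≡-sym (proj₂ (proj₂ (hit i)))) (trans (cong f e) (proj₂ (proj₂ (hit j)))))))

  -- With each cut placed at a missed cell, `contract` after `f` is a homotopy; its end lies in the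
  -- base, where `base-edge` makes it an endomorphism of `T`.
  toBase : n < L → ∀ {k} (valid : Valid k) (f : Hom T graph) →
    Σ (Hom T T) λ α → Path T graph f (baseHom valid α)
  toBase n<L valid (f , hf) = (α , hα) , homotopy⇒path (λ s → encode ∘ contract s ∘ decode ∘ f)
      (λ s∼t e → encode-edge (contract-edge (avoids _) (avoids _) s∼t (hf e)))
      (suc L) (f , hf) (baseHom valid (α , hα))
      (λ t → ≡-sym (trans (cong encode (contract-start (decode (f t)))) (strictlyInverseʳ (f t))))
      (λ t → cong encode (contract-end (decode (f t))))
    where
    open Cut (proj₁ ∘ missed n<L f)

    avoids : ∀ t → Avoids (decode (f t))
    avoids t k t′ e = proj₂ (missed n<L f k) t t′ (trans (≡-sym (strictlyInverseʳ (f t))) (cong encode e))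

    α : Fin n → Fin n
    α = retract ∘ decode ∘ f

    hα : IsHom T T α
    hα {u} {v} e = base-edge (≤-trans (s≤s z≤n) n<L)
      (subst₂ Edge (contract-end (decode (f u))) (contract-end (decode (f v)))
        (contract-edge {s = suc L} (avoids u) (avoids v) near-refl (hf e)))

  -- The slices of cylinder `k` themselves form the homotopy; `k₀` only serves to provide the base
  -- edges.
  along : ∀ {k₀ k} (v₀ : Valid k₀) → Valid k → (α : Hom T T) → glue k ≗ proj₁ α →
    Path T graph (baseHom v₀ (id , id)) (baseHom v₀ α)
  along {k = k} v₀ valid α glue≗α = homotopy⇒path (λ s → encode ∘ slice k s)
    (λ s∼t e → encode-edge (slice-edge k valid s∼t e))
    (suc L) (baseHom v₀ (id , id)) (baseHom v₀ α)
    (λ _ → refl)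
    (λ t → cong encode (trans (slice-end k t ≤-refl) (cong inj₁ (glue≗α t))))

  -- The stages 1 to `L` of `W` colour the cells; the remaining ones match the colours that `c` and
  -- the gluing force on the ends.
  wrap : ∀ γ → IsHom T T γ → (W : ℕ → Fin n → Fin r) → W 0 ≗ c → (∀ j → L < j → W j ≗ c ∘ γ) →
    (∀ {i j} → Near i j → Linked {T} {K r} (W i) (W j)) → Σ Cylinder λ k → Valid k × glue k ≗ γ
  wrap γ hγ W start end linked = k , (hglue , proper) , glue≗γ
    where
    k : Cylinder
    k = funToFin γ , funToFin {L} (λ i → funToFin (W (suc (toℕ i))))

    glue≗γ : glue k ≗ γ
    glue≗γ = finToFun-funToFin γ

    hglue : IsHom T T (glue k)
    hglue {u} {v} e = subst₂ (E T) (≡-sym (glue≗γ u)) (≡-sym (glue≗γ v)) (hγ e)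

    colour-slice : ∀ j t → colour (slice k j t) ≡ W j t
    colour-slice zero t = ≡-sym (start t)
    colour-slice (suc j) t with j <? L
    ... | yes j<L = trans (cong (λ x → finToFun x t) (finToFun-funToFin (λ i → funToFin (W (suc (toℕ i)))) (fromℕ< j<L)))
                      (trans (finToFun-funToFin (W (suc (toℕ (fromℕ< j<L)))) t) (cong (λ i → W (suc i) t) (toℕ-fromℕ< j<L)))
    ... | no j≮L = trans (cong c (glue≗γ t)) (≡-sym (end (suc j) (s≤s (≮⇒≥ j≮L)) t))

    proper : ∀ {i j u v} → Near i j → E T u v → colour (slice k i u) ≢ colour (slice k j v)
    proper {i} {j} {u} {v} i∼j e =
      subst₂ _≢_ (≡-sym (colour-slice i u)) (≡-sym (colour-slice j v)) (linked i∼j e)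

-- T is loopless because it has a proper colouring, so no edge of T has both ends at the vertex
-- where two adjacent colourings differ.
adjacent⇒linked : ∀ {T r} (f g : Hom T (K r)) → Adjacent {T} {K r} f g →
  Linked {T} {K r} (proj₁ f) (proj₁ g)
adjacent⇒linked (f , hf) (g , hg) (v , _ , same) {u} {w} e with u Fin.≟ v | w Fin.≟ v
... | no u≢v | _ = λ p → hg e (trans (≡-sym (same u u≢v)) p)
... | yes _ | no w≢v = λ p → hf e (trans p (≡-sym (same w w≢v)))
... | yes refl | yes refl = contradiction refl (hf e)

-- Paths of colourings as walks between codes.

module _ {T : Graph} {r : ℕ} where

  -- Codes range over all maps, so properness of `x` is recorded separately.
  Step : (x y : Fin (r ^ size T)) → Set
  Step x y = Linked {T} {K r} (finToFun x) (finToFun x) × Linked {T} {K r} (finToFun x) (finToFun y)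

  Codes : (Fin (size T) → Fin r) → Fin (r ^ size T) → Set
  Codes f x = finToFun x ≗ f

  linked-resp : ∀ {f f′ g g′} → f′ ≗ f → g′ ≗ g → Linked {T} {K r} f g → Linked {T} {K r} f′ g′
  linked-resp p q l {u} {v} e = subst₂ _≢_ (≡-sym (p u)) (≡-sym (q v)) (l e)

  -- Coding puts the colourings into a finite set with `r ^ size T` elements, to which `shorten`
  -- applies.
  path⇒walk : ∀ {f g} → Path T (K r) f g → ∃[ ℓ ] Walk Step (Codes (proj₁ f)) (Codes (proj₁ g)) ℓ
  path⇒walk {f , hf} (stay f≗g) = 0 , record
    { at = λ _ → funToFin f
    ; move = λ _ → proper , proper
    ; source = finToFun-funToFin f
    ; target = λ _ _ t → trans (finToFun-funToFin f t) (f≗g t)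
    }
    where
    proper : Linked {T} {K r} (finToFun (funToFin f)) (finToFun (funToFin f))
    proper = linked-resp {f} {_} {f} (finToFun-funToFin f) (finToFun-funToFin f) hf
  path⇒walk {f , hf} (step {g = g} a p) with path⇒walk p
  ... | ℓ , w = suc ℓ , record
    { at = λ { zero → funToFin f ; (suc j) → at w j }
    ; move = λ { zero → linked-resp (finToFun-funToFin f) (finToFun-funToFin f) hf ,
                        linked-resp (finToFun-funToFin f) (source w) (adjacent⇒linked {T} {r} (f , hf) g a)
               ; (suc j) → move w j }
    ; source = finToFun-funToFin f
    ; target = λ { (suc j) (s≤s ℓ≤j) → target w j ℓ≤j }
    }

  walk-linked : ∀ {P Q ℓ} (w : Walk Step P Q ℓ) {i j} → Near i j →
    Linked {T} {K r} (finToFun (at w i)) (finToFun (at w j))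
  walk-linked w {i} {j} i∼j with near-cases i∼j
  ... | inj₁ refl = proj₁ (move w i)
  ... | inj₂ (inj₁ refl) = proj₂ (move w i)
  ... | inj₂ (inj₂ refl) = linked-sym {T} {K r} {finToFun (at w j)} {finToFun (at w (suc j))} (proj₂ (move w j))

theorem3p1 : (T : Graph) → EndIsAut T → (χT : ℕ) → ChromaticNumber T χT →
    Σ (Hom T (K χT)) (λ c → (γ : Aut T) → Path T (K χT) c (precomp {T} {K χT} c γ)) →
    Σ Graph (λ G → ChromaticNumber G χT × HomConnected T G)
theorem3p1 T endIsAut χT (_ , minimal) ((c , hc) , invariant) =
  -- Restricting a colouring of `graph` along `ι` colours `T`, which gives the lower bound.
  graph , (colouring , λ j j<χT (f , hf) → minimal j j<χT (f ∘ proj₁ ι , hf ∘ proj₂ ι)) , ι , connected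
  where
  -- The first summand lets every hom miss a cell; the second leaves room for a shortened walk.
  open Cylinders T χT c (suc (size T) + χT ^ size T)

  n<L : size T < suc (size T) + χT ^ size T
  n<L = s≤s (m≤m+n (size T) (χT ^ size T))

  cylinder : ∀ γ → IsHom T T γ → Σ Cylinder λ k → Valid k × glue k ≗ γ
  -- `endIsAut` makes the endomorphism an automorphism, so that invariance provides a path.
  cylinder γ hγ with path⇒walk (invariant (γ , endIsAut γ hγ))
  ... | _ , longWalk with shorten _ _ _ longWalk
  ...   | w = wrap γ hγ (finToFun ∘ at w) (source w)
                (λ j L<j → target w j (≤-trans (m≤n+m (χT ^ size T) (suc (size T))) (<⇒≤ L<j)))
                (walk-linked {T} {χT} w)

  valid : Valid (proj₁ (cylinder id id))
  valid = proj₁ (proj₂ (cylinder id id))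

  ι : Hom T graph
  ι = baseHom valid (id , id)

  fromι : ∀ f → Path T graph ι f
  fromι f =
    let α , f⇝α = toBase n<L valid f
        k , valid-k , glue≗α = cylinder (proj₁ α) (proj₂ α)
    in path-trans (along valid valid-k α glue≗α) (path-sym f⇝α)

  connected : ∀ f g → Path T graph f g
  connected f g = path-trans (path-sym (fromι f)) (fromι g)
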